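{- Let $D$ be a strong digraph with $n$ vertices. If $d(u)+d(v)\geq 2n-3$ and $\min\{d^-(u)+d^+(v),\, d^+(u)+d^-(v)\}\geq n-2$ for every pair $\{u,v\}$ of nonadjacent vertices of $D$ that is dominated or dominating, then $D$ is supereulerian.
   Context: All digraphs are finite, loopless and without parallel arcs (a pair of opposite arcs $(x,y),(y,x)$ is allowed). $(w,z)$ denotes an arc from $w$ to $z$. For a vertex $x$, $d^-(x)$ and $d^+(x)$ are its in-degree and out-degree and $d(x)=d^-(x)+d^+(x)$. Two distinct vertices $u,v$ are nonadjacent if neither $(u,v)$ nor $(v,u)$ is an arc. A pair $\{u,v\}$ is dominated if there is a vertex $w$ with $(w,u),(w,v)\in A(D)$, and dominating if there is a vertex $w$ with $(u,w),(v,w)\in A(D)$. A digraph is strong if every vertex is reachable from every other vertex by a directed path. A digraph is supereulerian if it contains a closed directed trail (a closed walk with no repeated arcs) passing through every vertex, i.e. it has a spanning eulerian subdigraph. -}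

module Defs where

open import Data.Nat using (ℕ; zero; suc; _+_)
open import Data.Bool using (Bool; true; false; if_then_else_)
open import Data.Fin using (Fin)
open import Data.List using (List; []; _∷_; map; last)
open import Data.Nat.ListAction using (sum)
open import Data.List.Relation.Unary.All using (All)
open import Data.List.Relation.Unary.Unique.Propositional using (Unique)
open import Data.List.Membership.Propositional using (_∈_)
open import Data.Maybe using (just)
open import Data.Product using (_×_; _,_; Σ; ∃-syntax)
open import Data.Sum using (_⊎_)
open import Relation.Binary.PropositionalEquality using (_≡_)
open import Relation.Nullary using (¬_)
open import Data.List using (allFin)

record Digraph (n : ℕ) : Set where
  field
    arc      : Fin n → Fin n → Bool
    loopless : ∀ x → arc x x ≡ false

open Digraph public

module _ {n : ℕ} (D : Digraph n) where

  Arc : Fin n → Fin n → Set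
  Arc x y = arc D x y ≡ true

  countV : (Fin n → Bool) → ℕ
  countV b = sum (map (λ y → if b y then 1 else 0) (allFin n))

  outdeg : Fin n → ℕ
  outdeg x = countV (λ y → arc D x y)

  indeg : Fin n → ℕ
  indeg x = countV (λ y → arc D y x)

  deg : Fin n → ℕ
  deg x = indeg x + outdeg x

  Nonadjacent : Fin n → Fin n → Set
  Nonadjacent u v = ¬ (u ≡ v) × arc D u v ≡ false × arc D v u ≡ false

  Dominated : Fin n → Fin n → Set
  Dominated u v = ∃[ w ] (Arc w u × Arc w v)

  Dominating : Fin n → Fin n → Set
  Dominating u v = ∃[ w ] (Arc u w × Arc v w)

  data Reach : Fin n → Fin n → Set where
    here : ∀ {x} → Reach x x
    step : ∀ {x y z} → Arc x y → Reach y z → Reach x z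

  Strong : Set
  Strong = ∀ x y → Reach x y

  arcsOf : List (Fin n) → List (Fin n × Fin n)
  arcsOf []           = []
  arcsOf (x ∷ [])     = []
  arcsOf (x ∷ y ∷ ys) = (x , y) ∷ arcsOf (y ∷ ys)

  -- the vertex sequence x ∷ xs is a closed directed trail:
  -- consecutive vertices are joined by arcs, no arc is repeated,
  -- and it ends where it starts (length-0 trail allowed)
  IsClosedTrail : Fin n → List (Fin n) → Set
  IsClosedTrail x xs =
    All (λ p → Arc (Data.Product.proj₁ p) (Data.Product.proj₂ p)) (arcsOf (x ∷ xs))
    × Unique (arcsOf (x ∷ xs))
    × last (x ∷ xs) ≡ just x

  Supereulerian : Set
  Supereulerian = Σ (Fin n) λ x → Σ (List (Fin n)) λ xs →
    IsClosedTrail x xs × (∀ v → v ∈ (x ∷ xs))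

{-# OPTIONS --safe #-}
module Submission where

-- Partition the vertices into classes, each of which is covered exactly by a
-- closed trail (initially singletons), and suppose that no cyclic sequence of
-- trails through distinct classes can be linked by arcs into a larger one.
-- Write P s e if some trail from s to e covers exactly the class of s.
--
-- Rotation: if P s e holds, then P s v holds for more v than e has
-- out-neighbours in its class.  So if x → u joins two classes, P σ x and P u ω,
-- then counting gives d⁺(ω) + d⁻(σ) ≤ n − 2; when {σ , ω} is a nonadjacent
-- dominated or dominating pair, the semidegree condition makes this tight, and
-- then P w x holds for every w in the class of x that ω does not dominate, and
-- dually.  With an arc p → z back between the two classes, some such pair would
-- satisfy both bounds, against d(σ) + d(ω) ≥ 2n − 3; without one, tightness
-- yields a proper set of vertices that no arc leaves.  Hence an arc between two
-- classes forces all arcs between them in that direction, and following such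
-- arcs around a closed walk of classes merges them after all.

open import Defs
open import Data.Bool using (Bool; true; false; if_then_else_; _∧_; _∨_; not)
import Data.Bool.Properties as Bool
open import Data.Empty using (⊥; ⊥-elim)
open import Data.Fin using (Fin; zero; suc; _≟_)
import Data.Fin.Properties as Fin
open import Data.List using (List; []; _∷_; _++_; _∷ʳ_; [_]; map; concat; length; filter; filterᵇ;
  allFin; reverse; last; cartesianProduct)
open import Data.List.Properties using (++-assoc; ++-identityʳ; length-++; length-tabulate;
  unfold-reverse; filter-notAll)
open import Data.List.Reverse using (Reverse; []; _∶_∶ʳ_; reverseView)
import Data.List.Membership.DecPropositional as DecMembership
open import Data.List.Membership.Propositional using (_∈_; _∉_)
open import Data.List.Membership.Propositional.Properties using (∈-++⁺ˡ; ∈-++⁺ʳ; ∈-++⁻; ∈-∃++;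
  ∈-allFin; ∈-map⁺; ∈-map⁻; ∈-filter⁺; ∈-cartesianProduct⁺)
open import Data.List.Relation.Binary.Permutation.Propositional
  using (_↭_; ↭-refl; ↭-sym; ↭-trans; ↭-reflexive; ↭⇒↭ₛ)
open import Data.List.Relation.Binary.Permutation.Propositional.Properties
  using (∈-resp-↭; ↭-length; shifts; ++-comm; ++⁺ˡ; ∷↭∷ʳ; ↭-reverse)
import Data.List.Relation.Binary.Permutation.Setoid.Properties as PermutationSetoid
open import Data.List.Relation.Unary.All as All using (All; []; _∷_)
open import Data.List.Relation.Unary.AllPairs using ([]; _∷_)
open import Data.List.Relation.Unary.Any as Any using (here; there)
import Data.List.Relation.Unary.Unique.DecPropositional as DecUnique
open import Data.List.Relation.Unary.Unique.Propositional using (Unique)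
import Data.List.Relation.Unary.Unique.Propositional.Properties as Unique
open import Data.Maybe using (just)
import Data.Maybe.Properties as Maybe
open import Data.Nat using (ℕ; zero; suc; _+_; _*_; _≤_; _<_; _⊓_; z≤n; s≤s)
open import Data.Nat.ListAction using (sum)
open import Data.Nat.Properties hiding (_≟_)
open import Data.Nat.Tactic.RingSolver using (solve-∀)
open import Data.Product using (Σ; ∃-syntax; _×_; _,_; proj₁; proj₂; swap)
open import Data.Product.Properties using (≡-dec)
open import Data.Sum as Sum using (_⊎_; inj₁; inj₂)
open import Function using (_∘_)
open import Relation.Binary.PropositionalEquality hiding ([_])
open import Relation.Nullary using (¬_; Dec; yes; no; does)
open import Relation.Nullary.Decidable using (map′; _×-dec_; _⊎-dec_; ¬?; dec-true; dec-false;
  decidable-stable)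

-- Lists without repetitions, and counting by Boolean filters.

Unique-resp-↭ : ∀ {A : Set} {xs ys : List A} → xs ↭ ys → Unique xs → Unique ys
Unique-resp-↭ p = PermutationSetoid.Unique-resp-↭ (setoid _) (↭⇒↭ₛ p)

Unique-++⁻ˡ : ∀ {A : Set} (xs : List A) {ys} → Unique (xs ++ ys) → Unique xs
Unique-++⁻ˡ []       _        = []
Unique-++⁻ˡ (x ∷ xs) (x∉ ∷ u) =
  All.tabulate (λ i → All.lookup x∉ (∈-++⁺ˡ i)) ∷ Unique-++⁻ˡ xs u

Unique-∷⁺ : ∀ {A : Set} {x : A} {xs} → x ∉ xs → Unique xs → Unique (x ∷ xs)
Unique-∷⁺ x∉ u = All.tabulate (λ { i refl → x∉ i }) ∷ u

Unique-tail : ∀ {A : Set} {x : A} {xs} → Unique (x ∷ xs) → Unique xs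
Unique-tail (_ ∷ u) = u

unique-⊆-length : ∀ {A : Set} {xs ys : List A} →
  Unique xs → (∀ {x} → x ∈ xs → x ∈ ys) → length xs ≤ length ys
unique-⊆-length {xs = []}     _        _   = z≤n
unique-⊆-length {xs = x ∷ xs} (x∉ ∷ u) sub with ∈-∃++ (sub (here refl))
... | as , bs , refl = begin
  suc (length xs)           ≤⟨ s≤s (unique-⊆-length u sub′) ⟩
  suc (length (as ++ bs))   ≡⟨ ↭-length (↭-sym move) ⟩
  length (as ++ x ∷ bs)     ∎
  where
  open ≤-Reasoning
  move : as ++ x ∷ bs ↭ x ∷ (as ++ bs)
  move = shifts as [ x ]
  sub′ : ∀ {y} → y ∈ xs → y ∈ as ++ bs
  sub′ i with ∈-resp-↭ move (sub (there i))
  ... | here refl = ⊥-elim (All.lookup x∉ i refl)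
  ... | there j   = j

module _ {A : Set} (p : A → Bool) where

  ∈-filterᵇ⁺ : ∀ {x xs} → x ∈ xs → p x ≡ true → x ∈ filterᵇ p xs
  ∈-filterᵇ⁺ {xs = y ∷ ys} (here refl) px rewrite px = here refl
  ∈-filterᵇ⁺ {xs = y ∷ ys} (there i)   px with p y
  ... | true  = there (∈-filterᵇ⁺ i px)
  ... | false = ∈-filterᵇ⁺ i px

  ∈-filterᵇ⁻ : ∀ {x} xs → x ∈ filterᵇ p xs → p x ≡ true
  ∈-filterᵇ⁻ (y ∷ ys) i with p y in eq
  ∈-filterᵇ⁻ (y ∷ ys) (here refl) | true  = eq
  ∈-filterᵇ⁻ (y ∷ ys) (there i)   | true  = ∈-filterᵇ⁻ ys i
  ∈-filterᵇ⁻ (y ∷ ys) i           | false = ∈-filterᵇ⁻ ys i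

  filterᵇ-Unique : ∀ {xs} → Unique xs → Unique (filterᵇ p xs)
  filterᵇ-Unique {[]}     []       = []
  filterᵇ-Unique {x ∷ xs} (x∉ ∷ u) with p x
  ... | true  = All.tabulate (λ i → All.lookup x∉ (sub xs i)) ∷ filterᵇ-Unique u
    where
    sub : ∀ {y} xs → y ∈ filterᵇ p xs → y ∈ xs
    sub (z ∷ zs) i with p z
    sub (z ∷ zs) (here e)  | true  = here e
    sub (z ∷ zs) (there i) | true  = there (sub zs i)
    sub (z ∷ zs) i         | false = there (sub zs i)
  ... | false = filterᵇ-Unique u

  length-filterᵇ : ∀ xs → length (filterᵇ p xs) ≡ sum (map (λ y → if p y then 1 else 0) xs)
  length-filterᵇ []       = refl
  length-filterᵇ (x ∷ xs) with p x
  ... | true  = cong suc (length-filterᵇ xs)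
  ... | false = length-filterᵇ xs

true≢false : ∀ {b : Bool} → b ≡ true → b ≡ false → ⊥
true≢false refl ()

¬true⇒false : ∀ {b : Bool} → ¬ (b ≡ true) → b ≡ false
¬true⇒false {false} _ = refl
¬true⇒false {true}  h = ⊥-elim (h refl)

-- Walks, and trails that cover a vertex set exactly.

rev : ∀ {n} → Digraph n → Digraph n
rev D = record { arc = λ x y → arc D y x ; loopless = loopless D }

module _ {n : ℕ} where

  V A : Set
  V = Fin n
  A = V × V

  _≟A_ : (a b : A) → Dec (a ≡ b)
  _≟A_ = ≡-dec _≟_ _≟_

  _∈A?_ : (a : A) (as : List A) → Dec (a ∈ as)
  _∈A?_ = DecMembership._∈?_ _≟A_

  _∈V?_ : (v : V) (vs : List V) → Dec (v ∈ vs)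
  _∈V?_ = DecMembership._∈?_ _≟_

  module _ (D : Digraph n) where

    sel : (V → Bool) → List V
    sel p = filterᵇ p (allFin n)

    length-sel : ∀ p → length (sel p) ≡ countV D p
    length-sel p = length-filterᵇ p (allFin n)

    data Walk : V → List A → V → Set where
      []  : ∀ {x} → Walk x [] x
      _∷_ : ∀ {x y as z} → Arc D x y → Walk y as z → Walk x ((x , y) ∷ as) z

    infixr 5 _++ʷ_
    _++ʷ_ : ∀ {x as y bs z} → Walk x as y → Walk y bs z → Walk x (as ++ bs) z
    []      ++ʷ v = v
    (a ∷ w) ++ʷ v = a ∷ (w ++ʷ v)

    splitʷ : ∀ as {bs x z} → Walk x (as ++ bs) z → ∃[ y ] Walk x as y × Walk y bs z
    splitʷ []       w       = _ , [] , w
    splitʷ (_ ∷ as) (a ∷ w) with splitʷ as w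
    ... | y , u , v = y , a ∷ u , v

    Hit : List A → V → Set
    Hit as v = ∃[ u ] (u , v) ∈ as

    end-hit : ∀ {x as z} → Walk x as z → z ≡ x ⊎ Hit as z
    end-hit []      = inj₁ refl
    end-hit (a ∷ w) with end-hit w
    ... | inj₁ refl    = inj₂ (_ , here refl)
    ... | inj₂ (u , i) = inj₂ (u , there i)

    -- `Hit` sees only the heads of arcs, so the start is treated separately; this also lets the
    -- empty trail cover a singleton. Carrying the arc list as an index reduces rearrangements of a
    -- trail to permutations of lists.
    record Trail (S : V → Set) (s : V) (as : List A) (e : V) : Set where
      constructor mkTrail
      field
        walk  : Walk s as e
        uniq  : Unique as
        start : S s
        sound : ∀ {v} → Hit as v → S v
        cover : ∀ {v} → S v → v ≡ s ⊎ Hit as v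

    Tr : (V → Set) → V → V → Set
    Tr S s e = ∃[ as ] Trail S s as e

    append : ∀ {S s as e w} → Trail S s as e → Arc D e w → S w → (e , w) ∉ as →
      Trail S s (as ∷ʳ (e , w)) w
    append {S} {s} {as} {e} {w} T a Sw new = record
      { walk  = walk ++ʷ (a ∷ [])
      ; uniq  = Unique-resp-↭ (∷↭∷ʳ (e , w) as) (Unique-∷⁺ new uniq)
      ; start = start
      ; sound = λ { (u , i) → snd (∈-++⁻ as i) }
      ; cover = λ Sv → Sum.map₂ (λ { (u , i) → u , ∈-++⁺ˡ i }) (cover Sv)
      }
      where
      open Trail T
      snd : ∀ {u v} → (u , v) ∈ as ⊎ (u , v) ∈ [ (e , w) ] → S v
      snd (inj₁ i)           = sound (_ , i)
      snd (inj₂ (here refl)) = Sw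

    -- Rotation: the possible ends of a trail with a fixed start.

    Shorter : (V → Set) → V → List A → V → Set
    Shorter S s as e = ∃[ as′ ] Trail S s as′ e × length as′ < length as

    -- Cutting a trail at its departures from e makes every arc of the trail out
    -- of e the first arc of exactly one block.
    record BlockOf (e : V) (b : List A) : Set where
      constructor mkBlock
      field
        head   : V
        rest   : List A
        is-∷   : b ≡ (e , head) ∷ rest
        closed : Walk e b e
        once   : ∀ w → (e , w) ∉ rest

    blocks : ∀ {v as e} → Walk v as e →
      ∃[ α ] Σ (List (List A)) λ bs →
        as ≡ α ++ concat bs × Walk v α e × All (BlockOf e) bs × (∀ w → (e , w) ∉ α)
    blocks [] = [] , [] , refl , [] , [] , λ _ ()
    blocks {v} {e = e} (a ∷ w) with blocks w | v ≟ e
    ... | α , bs , refl , u , B , once | yes refl =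
      [] , ((v , _) ∷ α) ∷ bs , refl , [] , mkBlock _ α refl (a ∷ u) once ∷ B , λ _ ()
    ... | α , bs , refl , u , B , once | no v≢e =
      (v , _) ∷ α , bs , refl , a ∷ u , B , λ { w′ (here refl) → v≢e refl ; w′ (there i) → once w′ i }

    -- Each block is to contribute an end of its own. Here `b` is run last, after `W`, and `cs`
    -- holds the ends contributed by earlier blocks. All of `cs` is visited by `W`, so undoing `b`
    -- can pass over those vertices.
    module LastBlock {S : V → Set} {s e : V} {as W b : List A}
      (T : Trail S s as e) (as↭ : as ↭ W ++ b) (w₀ : Walk s W e) (B : BlockOf e b)
      (N : V → Bool) (N-new : ∀ {c} → N c ≡ true → Arc D e c × (e , c) ∉ as)
      (cs : List V) (cs-hit : ∀ {c} → c ∈ cs → Hit W c) where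

      open Trail T

      New : Set
      New = ∃[ c ] Tr S s c × c ≢ e × N c ≡ false × c ∉ cs × Hit b c

      drop-last : ∀ {X π d c x} → (c ≡ s ⊎ Hit W c) → Trail S s (W ++ X ++ π ∷ʳ (d , c)) x →
        Walk s (W ++ X ++ π) d → Trail S s (W ++ X ++ π) d
      drop-last {X} {π} {d} {c} hit T′ w = record
        { walk = w
        ; uniq = Unique-++⁻ˡ (W ++ X ++ π) (subst Unique shape (Trail.uniq T′))
        ; start = start
        ; sound = λ { (u , i) → Trail.sound T′ (u , subst ((u , _) ∈_) (sym shape) (∈-++⁺ˡ i)) }
        ; cover = λ Sv → cov (Trail.cover T′ Sv)
        }
        where
        shape : W ++ X ++ π ∷ʳ (d , c) ≡ (W ++ X ++ π) ++ [ (d , c) ]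
        shape = trans (cong (W ++_) (sym (++-assoc X π _))) (sym (++-assoc W (X ++ π) _))
        cov : ∀ {v} → v ≡ s ⊎ Hit (W ++ X ++ π ∷ʳ (d , c)) v → v ≡ s ⊎ Hit (W ++ X ++ π) v
        cov (inj₁ v≡s) = inj₁ v≡s
        cov (inj₂ (u , i)) with ∈-++⁻ (W ++ X ++ π) (subst ((u , _) ∈_) shape i)
        ... | inj₁ j = inj₂ (u , j)
        ... | inj₂ (here refl) = Sum.map₂ (λ { (u′ , j) → u′ , ∈-++⁺ˡ j }) hit

      restart : ∀ {π d c ρ} → b ≡ π ++ (d , c) ∷ ρ → N c ≡ true →
        Walk s (W ++ ((e , c) ∷ ρ) ++ π) d → Trail S s (W ++ ((e , c) ∷ ρ) ++ π) d
      restart {π} {d} {c} {ρ} refl Nc w = record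
        { walk = w
        ; uniq = Unique-resp-↭ (↭-sym (shifts W [ (e , c) ]))
            (Unique-∷⁺ new (Unique-tail (Unique-resp-↭ perm uniq)))
        ; start = start
        ; sound = snd
        ; cover = λ Sv → cov (cover Sv)
        }
        where
        perm : as ↭ (d , c) ∷ (W ++ ρ ++ π)
        perm = ↭-trans as↭ (↭-trans (++⁺ˡ W (++-comm π ((d , c) ∷ ρ))) (shifts W [ (d , c) ]))
        new : (e , c) ∉ W ++ ρ ++ π
        new i = proj₂ (N-new Nc) (∈-resp-↭ (↭-sym perm) (there i))
        snd : ∀ {v} → Hit (W ++ ((e , c) ∷ ρ) ++ π) v → S v
        snd (u , i) with ∈-resp-↭ (shifts W [ (e , c) ]) i
        ... | here refl = sound (d , ∈-resp-↭ (↭-sym perm) (here refl))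
        ... | there j   = sound (u , ∈-resp-↭ (↭-sym perm) (there j))
        cov : ∀ {v} → v ≡ s ⊎ Hit as v → v ≡ s ⊎ Hit (W ++ ((e , c) ∷ ρ) ++ π) v
        cov (inj₁ v≡s) = inj₁ v≡s
        cov (inj₂ (u , i)) with ∈-resp-↭ perm i
        ... | here refl = inj₂ (e , ∈-++⁺ʳ W (here refl))
        ... | there j   = inj₂ (u , ∈-resp-↭ (↭-sym (shifts W [ (e , c) ])) (there j))

      snocʷ : ∀ π {x d c z} → Walk x (π ∷ʳ (d , c)) z → Walk x π d × Arc D d c × c ≡ z
      snocʷ π w with splitʷ π w
      ... | _ , u , (a ∷ []) = u , a , refl

      -- The block b = π ++ ρ is undone from its end; the current trail runs through W, then θ,
      -- then π, and ends at c.  If W already visits c, the last arc of π is superfluous.  If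
      -- N c, the new arc e → c followed by ρ can be traversed before π, again freeing that arc.
      -- Otherwise c is a new end.  Once b is exhausted, a shorter trail from s to e is left.
      back : ∀ {π} → Reverse π → ∀ {c ρ θ} → b ≡ π ++ ρ →
        Walk e π c → Walk c ρ e → Walk e θ e →
        length θ < length b → Trail S s (W ++ θ ++ π) c → Shorter S s as e ⊎ New
      back [] {θ = θ} refl [] wρ wθ θ<b T′ = inj₁ (_ , T′ , (begin-strict
          length (W ++ θ ++ [])    ≡⟨ length-++ W ⟩
          length W + length (θ ++ []) ≡⟨ cong (λ l → length W + length l) (++-identityʳ θ) ⟩
          length W + length θ      <⟨ +-monoʳ-< (length W) θ<b ⟩
          length W + length b      ≡⟨ length-++ W ⟨
          length (W ++ b)          ≡⟨ ↭-length as↭ ⟨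
          length as                ∎))
        where open ≤-Reasoning
      back (π ∶ r ∶ʳ (d , c′)) {c} {ρ} {θ} eq wπ wρ wθ θ<b T′ with snocʷ π wπ
      ... | wπ′ , a , refl = go (c ≟ e) (c ∈V? cs) (N c) refl
        where
        eq′ : b ≡ π ++ (d , c) ∷ ρ
        eq′ = trans eq (++-assoc π [ (d , c) ] ρ)
        skip : c ≡ s ⊎ Hit W c → Shorter S s as e ⊎ New
        skip hit = back r eq′ wπ′ (a ∷ wρ) wθ θ<b (drop-last {θ} {π} hit T′ (w₀ ++ʷ wθ ++ʷ wπ′))
        go : Dec (c ≡ e) → Dec (c ∈ cs) → (k : Bool) → N c ≡ k → Shorter S s as e ⊎ New
        go (yes refl) _ _ _ = skip (end-hit w₀)
        go (no _) (yes i) _ _ = skip (inj₂ (cs-hit i))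
        go (no c≢e) (no c∉) false Nc =
          inj₂ (c , (_ , T′) , c≢e , Nc , c∉ , d , subst ((d , c) ∈_) (sym eq′) (∈-++⁺ʳ π (here refl)))
        go (no c≢e) (no c∉) true Nc =
          back r eq′ wπ′ (a ∷ wρ) (proj₁ (N-new Nc) ∷ wρ) (short π eq′ wπ′)
            (restart eq′ Nc (w₀ ++ʷ (proj₁ (N-new Nc) ∷ wρ) ++ʷ wπ′))
          where
          short : ∀ π → b ≡ π ++ (d , c) ∷ ρ → Walk e π d → suc (length ρ) < length b
          -- An empty `π` would make `d` equal to `e` and put `e → c` on the trail, against `N-new`.
          -- With `π` nonempty the new closed walk is strictly shorter than `b`.
          short [] eq″ [] = ⊥-elim (proj₂ (N-new Nc) (∈-resp-↭ (↭-sym as↭)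
            (∈-++⁺ʳ W (subst ((e , c) ∈_) (sym eq″) (here refl)))))
          short (x ∷ π) refl _ = s≤s (subst (suc (length ρ) ≤_) (sym (length-++ π)) (m≤n+m _ (length π)))

      result : Shorter S s as e ⊎ New
      result = back (reverseView b) (sym (++-identityʳ b)) (BlockOf.closed B) [] [] (pos B) (record
        { walk = w₀ ++ʷ BlockOf.closed B
        ; uniq = Unique-resp-↭ as↭ uniq
        ; start = start
        ; sound = λ { (u , i) → sound (u , ∈-resp-↭ (↭-sym as↭) i) }
        ; cover = λ Sv → Sum.map₂ (λ { (u , i) → u , ∈-resp-↭ as↭ i }) (cover Sv) })
        where
        pos : BlockOf e b → 0 < length b
        pos (mkBlock _ _ refl _ _) = s≤s z≤n

    module _ {S : V → Set} (c : V → Bool) (c⇒S : ∀ {w} → c w ≡ true → S w) where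

      -- The extra one is `e` itself. The Boolean `c` stands in for `S` because `countV` counts
      -- Boolean predicates.
      Ends : V → V → Set
      Ends s e = Σ (List V) λ L → Unique L × (∀ {v} → v ∈ L → Tr S s v)
        × suc (countV D (λ w → c w ∧ arc D e w)) ≤ length L

      private
        module _ {s e : V} {as : List A} (T : Trail S s as e) where
          open Trail T

          N : V → Bool
          N w = (c w ∧ arc D e w) ∧ not (does ((e , w) ∈A? as))

          N⁻ : ∀ {w} → N w ≡ true → c w ≡ true × Arc D e w × (e , w) ∉ as
          N⁻ {w} Nw with c w | arc D e w in aeq | (e , w) ∈A? as
          N⁻ {w} refl | true | true | no ∉as = refl , refl , ∉as

          N⁺ : ∀ {w} → (c w ∧ arc D e w) ≡ true → (e , w) ∉ as → N w ≡ true
          N⁺ {w} p ∉as rewrite p with (e , w) ∈A? as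
          ... | yes i = ⊥-elim (∉as i)
          ... | no _  = refl

          Chosen : ℕ → Set
          Chosen k = Σ (List V) λ cs → Unique cs × length cs ≡ k
            × (∀ {v} → v ∈ cs → Tr S s v × v ≢ e × N v ≡ false)

          -- Blocks are closed walks at `e`, so their order is free. `δ` collects the blocks already
          -- treated, and the current block moves behind the remaining ones; the ends chosen so far
          -- are then all visited before it.
          choose : ∀ {α} → Walk s α e → ∀ {k} δ → Walk e δ e → ∀ bs → All (BlockOf e) bs →
            as ↭ α ++ δ ++ concat bs →
            (ch : Chosen k) → (∀ {v} → v ∈ proj₁ ch → Hit δ v) →
            Shorter S s as e ⊎ Chosen (length bs + k)
          choose wα δ wδ [] [] _ ch _ = inj₂ ch
          choose {α} wα {k} δ wδ (b ∷ bs) (B ∷ Bs) p ch@(cs , u , len , good) hit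
            with LastBlock.result T perm (wα ++ʷ wδ ++ʷ closeds Bs) B N (λ Nc → proj₂ (N⁻ Nc)) cs
                   (λ i → _ , ∈-++⁺ʳ α (∈-++⁺ˡ (proj₂ (hit i))))
            where
            closeds : ∀ {bs} → All (BlockOf e) bs → Walk e (concat bs) e
            closeds []       = []
            closeds (B ∷ Bs) = BlockOf.closed B ++ʷ closeds Bs
            perm : as ↭ (α ++ δ ++ concat bs) ++ b
            perm = ↭-trans p (↭-trans (++⁺ˡ α (++⁺ˡ δ (++-comm b (concat bs))))
              (↭-reflexive (trans (cong (α ++_) (sym (++-assoc δ _ b))) (sym (++-assoc α _ b)))))
          ... | inj₁ sh = inj₁ sh
          ... | inj₂ (v , tr , v≢e , Nv , v∉ , hb) =
            Sum.map₂ (subst Chosen (+-suc (length bs) k))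
              (choose wα (b ++ δ) (BlockOf.closed B ++ʷ wδ) bs Bs
                (↭-trans p (++⁺ˡ α (↭-trans (shifts δ b) (↭-reflexive (sym (++-assoc b δ _))))))
                (v ∷ cs , Unique-∷⁺ v∉ u , cong suc len ,
                  λ { (here refl) → tr , v≢e , Nv ; (there i) → good i })
                (λ { (here refl) → proj₁ hb , ∈-++⁺ˡ (proj₂ hb)
                   ; (there i)   → _ , ∈-++⁺ʳ b (proj₂ (hit i)) }))

          -- An out-neighbour of `e` counted by `c` either has its arc from `e` off the trail, and
          -- then that arc can be appended, or is the head of a block, and each block has yielded an
          -- end outside `N`.
          bounded : Shorter S s as e ⊎ Ends s e
          bounded with blocks walk
          ... | α , bs , refl , wα , Bs , once
            with choose wα [] [] bs Bs ↭-refl ([] , [] , refl , λ ()) (λ ())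
          ... | inj₁ sh = inj₁ sh
          ... | inj₂ (cs , u , len , good) = inj₂ (e ∷ sel N ++ cs , uL , ok , lenL)
            where
            ok : ∀ {v} → v ∈ e ∷ sel N ++ cs → Tr S s v
            ok (here refl) = _ , T
            ok (there i) with ∈-++⁻ (sel N) i
            ... | inj₁ j = let cw , a , ∉as = N⁻ (∈-filterᵇ⁻ N (allFin n) j) in
                _ , append T a (c⇒S cw) ∉as
            ... | inj₂ j = proj₁ (good j)
            e∉ : e ∉ sel N ++ cs
            e∉ i with ∈-++⁻ (sel N) i
            ... | inj₁ j with () ← trans (sym (loopless D e)) (proj₁ (proj₂ (N⁻ (∈-filterᵇ⁻ N (allFin n) j))))
            ... | inj₂ j = proj₁ (proj₂ (good j)) refl
            uL : Unique (e ∷ sel N ++ cs)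
            uL = Unique-∷⁺ e∉ (Unique.++⁺ (filterᵇ-Unique N (Unique.allFin⁺ n)) u
              (λ { (i , j) → true≢false (∈-filterᵇ⁻ N (allFin n) i) (proj₂ (proj₂ (good j))) }))
            heads : ∀ {bs} → All (BlockOf e) bs → List V
            heads []       = []
            heads (B ∷ Bs) = BlockOf.head B ∷ heads Bs
            length-heads : ∀ {bs} (Bs : All (BlockOf e) bs) → length (heads Bs) ≡ length bs
            length-heads []       = refl
            length-heads (B ∷ Bs) = cong suc (length-heads Bs)
            in-heads : ∀ {bs} (Bs : All (BlockOf e) bs) {w} → (e , w) ∈ concat bs → w ∈ heads Bs
            in-heads (mkBlock h r refl cl on ∷ Bs) {w} i with ∈-++⁻ ((e , h) ∷ r) i
            ... | inj₁ (here refl) = here refl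
            ... | inj₁ (there j)   = ⊥-elim (on w j)
            ... | inj₂ j           = there (in-heads Bs j)
            out : V → Bool
            out w = c w ∧ arc D e w
            outs⊆ : ∀ {w} → w ∈ sel out → w ∈ sel N ++ heads Bs
            outs⊆ {w} i with (e , w) ∈A? (α ++ concat bs)
            ... | no ∉as = ∈-++⁺ˡ (∈-filterᵇ⁺ N (∈-allFin w) (N⁺ (∈-filterᵇ⁻ out (allFin n) i) ∉as))
            ... | yes j with ∈-++⁻ α j
            ...   | inj₁ j′ = ⊥-elim (once w j′)
            ...   | inj₂ j′ = ∈-++⁺ʳ (sel N) (in-heads Bs j′)
            lenL : suc (countV D out) ≤ suc (length (sel N ++ cs))
            lenL = s≤s (begin
              countV D out                       ≡⟨ length-sel out ⟨
              length (sel out)                   ≤⟨ unique-⊆-length (filterᵇ-Unique out (Unique.allFin⁺ n)) outs⊆ ⟩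
              length (sel N ++ heads Bs)         ≡⟨ length-++ (sel N) ⟩
              length (sel N) + length (heads Bs)
                ≡⟨ cong (length (sel N) +_) (trans (length-heads Bs) (sym (trans len (+-identityʳ _)))) ⟩
              length (sel N) + length cs         ≡⟨ length-++ (sel N) ⟨
              length (sel N ++ cs)               ∎)
              where open ≤-Reasoning

      -- `Shorter` keeps both ends of the trail, so descent on its length reaches a trail for which
      -- the count succeeds.
      many-ends : ∀ {s e} → Tr S s e → Ends s e
      many-ends (as , T) = go (suc (length as)) T ≤-refl
        where
        go : ∀ k {as s e} → Trail S s as e → length as < k → Ends s e
        go (suc k) T (s≤s l) with bounded T
        ... | inj₁ (_ , T′ , l′) = go k T′ (≤-trans l′ l)
        ... | inj₂ r             = r

  -- Reversing, joining, rotating and cutting trails.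

  module _ (D : Digraph n) where

    -- Reversal turns tails into heads, so the cover of the reversed trail has to be read off the
    -- tails.
    visited-tail : ∀ {s as e} → Walk D s as e → ∀ {v} → v ≡ s ⊎ Hit D as v →
      v ≡ e ⊎ (∃[ u ] (v , u) ∈ as)
    visited-tail []      (inj₁ refl) = inj₁ refl
    visited-tail (a ∷ w) (inj₁ refl) = inj₂ (_ , here refl)
    visited-tail (a ∷ w) (inj₂ (_ , here refl)) =
      Sum.map₂ (λ { (u , i) → u , there i }) (visited-tail w (inj₁ refl))
    visited-tail (a ∷ w) (inj₂ (_ , there i)) =
      Sum.map₂ (λ { (u , i) → u , there i }) (visited-tail w (inj₂ (_ , i)))

    tail-visited : ∀ {s as e} → Walk D s as e → ∀ {u v} → (u , v) ∈ as → u ≡ s ⊎ Hit D as u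
    tail-visited (a ∷ w) (here refl) = inj₁ refl
    tail-visited (a ∷ w) (there i) with tail-visited w i
    ... | inj₁ refl    = inj₂ (_ , here refl)
    ... | inj₂ (_ , j) = inj₂ (_ , there j)

    reverse-walk : ∀ {s as e} → Walk D s as e → Walk (rev D) e (reverse (map swap as)) s
    reverse-walk []              = []
    reverse-walk {as = a ∷ as} (p ∷ w) =
      subst (λ l → Walk (rev D) _ l _) (sym (unfold-reverse (swap a) (map swap as)))
        (_++ʷ_ (rev D) (reverse-walk w) (p ∷ []))

    reverse-Tr : ∀ {S s e} → Tr D S s e → Tr (rev D) S e s
    reverse-Tr {S} {s} {e} (as , T) = reverse (map swap as) , record
      { walk  = reverse-walk walk
      ; uniq  = Unique-resp-↭ (↭-sym (↭-reverse _)) (Unique.map⁺ (λ { refl → refl }) uniq)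
      ; start = visited (end-hit D walk)
      ; sound = λ { (u , i) → visited (tail-visited walk (back i)) }
      ; cover = λ Sv → Sum.map₂ (λ { (u , i) → u , forth i }) (visited-tail walk (cover Sv))
      }
      where
      open Trail T
      visited : ∀ {v} → v ≡ s ⊎ Hit D as v → S v
      visited (inj₁ refl) = start
      visited (inj₂ h)    = sound h
      back : ∀ {u v} → (u , v) ∈ reverse (map swap as) → (v , u) ∈ as
      back i with ∈-map⁻ swap (∈-resp-↭ (↭-reverse (map swap as)) i)
      ... | _ , j , refl = j
      forth : ∀ {u v} → (v , u) ∈ as → (u , v) ∈ reverse (map swap as)
      forth i = ∈-resp-↭ (↭-sym (↭-reverse _)) (∈-map⁺ swap i)

  module _ (D : Digraph n) where

    many-starts : ∀ {S : V → Set} (c : V → Bool) → (∀ {w} → c w ≡ true → S w) →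
      ∀ {s e} → Tr D S s e → Σ (List V) λ L → Unique L × (∀ {v} → v ∈ L → Tr D S v e)
        × suc (countV D (λ w → c w ∧ arc D w s)) ≤ length L
    many-starts c c⇒S t with many-ends (rev D) c c⇒S (reverse-Tr D t)
    ... | L , u , ends , len = L , u , (λ i → reverse-Tr (rev D) (ends i)) , len

    end∈ : ∀ {S s e} → Tr D S s e → S e
    end∈ (as , T) with end-hit D (Trail.walk T)
    ... | inj₁ refl = Trail.start T
    ... | inj₂ h    = Trail.sound T h

    map-Tr : ∀ {S S′ : V → Set} → (∀ {v} → S v → S′ v) → (∀ {v} → S′ v → S v) →
      ∀ {s e} → Tr D S s e → Tr D S′ s e
    map-Tr f g (as , mkTrail w u st so co) = as , mkTrail w u (f st) (f ∘ so) (co ∘ g)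

    tail∈ : ∀ {S s as e} → Trail D S s as e → ∀ {u v} → (u , v) ∈ as → S u
    tail∈ T i with tail-visited D (Trail.walk T) i
    ... | inj₁ refl = Trail.start T
    ... | inj₂ h    = Trail.sound T h

    -- The heads of the arcs lie in `S` before the joining arc and in `S′` from it on, so only the
    -- joining arc and the second trail need separating; the tail of that arc does so.
    join : ∀ {S S′ : V → Set} {s as e s′ bs e′} → (∀ {v} → S v → S′ v → ⊥) →
      Trail D S s as e → Trail D S′ s′ bs e′ → Arc D e s′ →
      Trail D (λ v → S v ⊎ S′ v) s (as ++ (e , s′) ∷ bs) e′
    join {S} {S′} {s} {as} {e} {s′} {bs} disj T T′ a = record
      { walk  = _++ʷ_ D (Trail.walk T) (a ∷ Trail.walk T′)
      ; uniq  = Unique.++⁺ (Trail.uniq T) (Unique-∷⁺ new (Trail.uniq T′)) apart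
      ; start = inj₁ (Trail.start T)
      ; sound = λ { (u , i) → snd (∈-++⁻ as i) }
      ; cover = cov
      }
      where
      new : (e , s′) ∉ bs
      new i = disj (end∈ (_ , T)) (tail∈ T′ i)
      apart : ∀ {x} → x ∈ as × x ∈ (e , s′) ∷ bs → ⊥
      apart (i , here refl) = disj (Trail.sound T (_ , i)) (Trail.start T′)
      apart (i , there j)   = disj (Trail.sound T (_ , i)) (Trail.sound T′ (_ , j))
      snd : ∀ {u v} → (u , v) ∈ as ⊎ (u , v) ∈ (e , s′) ∷ bs → S v ⊎ S′ v
      snd (inj₁ i)           = inj₁ (Trail.sound T (_ , i))
      snd (inj₂ (here refl)) = inj₂ (Trail.start T′)
      snd (inj₂ (there i))   = inj₂ (Trail.sound T′ (_ , i))
      cov : ∀ {v} → S v ⊎ S′ v → v ≡ s ⊎ Hit D (as ++ (e , s′) ∷ bs) v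
      cov (inj₁ Sv) = Sum.map₂ (λ { (u , i) → u , ∈-++⁺ˡ i }) (Trail.cover T Sv)
      cov (inj₂ Sv) with Trail.cover T′ Sv
      ... | inj₁ refl    = inj₂ (e , ∈-++⁺ʳ as (here refl))
      ... | inj₂ (u , i) = inj₂ (u , ∈-++⁺ʳ as (there i))

    rotate : ∀ {S s v} → Tr D S s s → S v → Tr D S v v
    rotate {S} {s} {v} (as , T) Sv with Trail.cover T Sv
    ... | inj₁ refl = as , T
    ... | inj₂ (u , i) with ∈-∃++ i
    ...   | ys , zs , refl with splitʷ D ys (Trail.walk T)
    ...     | _ , wy , (a ∷ wz) = zs ++ ys ∷ʳ (u , v) , record
      { walk  = _++ʷ_ D wz (_++ʷ_ D wy (a ∷ []))
      ; uniq  = Unique-resp-↭ perm (Trail.uniq T)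
      ; start = Sv
      ; sound = λ { (x , i) → Trail.sound T (x , ∈-resp-↭ (↭-sym perm) i) }
      ; cover = λ Sx → cov (Trail.cover T Sx)
      }
      where
      perm : ys ++ (u , v) ∷ zs ↭ zs ++ ys ∷ʳ (u , v)
      perm = ↭-trans (↭-reflexive (sym (++-assoc ys [ (u , v) ] zs))) (++-comm (ys ∷ʳ (u , v)) zs)
      cov : ∀ {x} → x ≡ s ⊎ Hit D (ys ++ (u , v) ∷ zs) x → x ≡ v ⊎ Hit D (zs ++ ys ∷ʳ (u , v)) x
      cov (inj₁ refl)    = Sum.map₂ (λ { (x , i) → x , ∈-++⁺ˡ i }) (end-hit D wz)
      cov (inj₂ (x , i)) = inj₂ (x , ∈-resp-↭ perm i)

    merge : ∀ {S S′ : V → Set} {s e s′ e′} → (∀ {v} → S v → S′ v → ⊥) →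
      Tr D S s e → Tr D S′ s′ e′ → Arc D e s′ → Arc D e′ s →
      Tr D (λ v → S v ⊎ S′ v) s s
    merge {s = s} {e} {s′} {e′} disj (as , T) (bs , T′) a a′ =
      _ , append D (join disj T T′ a) a′ (inj₁ (Trail.start T)) new
      where
      new : (e′ , s) ∉ as ++ (e , s′) ∷ bs
      new i with ∈-++⁻ as i
      ... | inj₁ j           = disj (tail∈ T j) (end∈ (_ , T′))
      ... | inj₂ (here refl) = disj (Trail.start T) (Trail.start T′)
      ... | inj₂ (there j)   = disj (Trail.start T) (Trail.sound T′ (_ , j))

    crossing-arc : (q : V → Bool) → ∀ {s as e} → Walk D s as e →
      q s ≡ false → ∀ {b} → Hit D as b → q b ≡ true →
      ∃[ α ] ∃[ v ] ∃[ z ] ∃[ β ] as ≡ α ++ (v , z) ∷ β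
        × Walk D s α v × Arc D v z × Walk D z β e × q v ≡ false × q z ≡ true
    crossing-arc q (_∷_ {y = y} a w) qs h qb with q y in qy
    ... | true = [] , _ , _ , _ , refl , [] , a , w , qs , qy
    crossing-arc q (a ∷ w) qs (_ , here refl) qb | false = ⊥-elim (true≢false qb qy)
    crossing-arc q (a ∷ w) qs (_ , there i)   qb | false with crossing-arc q w qy (_ , i) qb
    ... | α , v , z , β , refl , wα , a′ , wβ , qv , qz =
      _ , v , z , β , refl , a ∷ wα , a′ , wβ , qv , qz

    -- The closed trail has to enter `q` somewhere. Without the entering arc `v → z` it opens into a
    -- trail from `z` to `v`, which still covers `S` because `z` is now its start. With `q` testing
    -- arcs to or from a fixed vertex, this supplies the linked pairs for the degree condition.
    transition : ∀ {S : V → Set} (q : V → Bool) {a b} → Tr D S a a → q a ≡ false → S b → q b ≡ true →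
      ∃[ v ] ∃[ z ] Arc D v z × Tr D S z v × q v ≡ false × q z ≡ true
    transition {S} q {a} {b} (as , T) qa Sb qb with Trail.cover T Sb
    ... | inj₁ refl = ⊥-elim (true≢false qb qa)
    ... | inj₂ h with crossing-arc q (Trail.walk T) qa h qb
    ...   | α , v , z , β , refl , wα , vz , wβ , qv , qz = v , z , vz , (β ++ α , record
      { walk  = _++ʷ_ D wβ wα
      ; uniq  = Unique-tail (Unique-resp-↭ perm (Trail.uniq T))
      ; start = Trail.sound T (v , ∈-++⁺ʳ α (here refl))
      ; sound = λ { (x , i) → Trail.sound T (x , ∈-resp-↭ (↭-sym perm) (there i)) }
      ; cover = λ Sx → cov (Trail.cover T Sx)
      }) , qv , qz
      where
      perm : α ++ (v , z) ∷ β ↭ (v , z) ∷ (β ++ α)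
      perm = ++-comm α ((v , z) ∷ β)
      cov : ∀ {x} → x ≡ a ⊎ Hit D (α ++ (v , z) ∷ β) x → x ≡ z ⊎ Hit D (β ++ α) x
      cov (inj₁ refl) = Sum.map₂ (λ { (x , i) → x , ∈-++⁺ˡ i }) (end-hit D wβ)
      cov (inj₂ (x , i)) with ∈-resp-↭ perm i
      ... | here refl = inj₁ refl
      ... | there j   = inj₂ (x , j)

-- Degree bounds from arcs between classes that cannot be merged.

sum-+-≤ : ∀ {A : Set} (f g h : A → ℕ) (k l : A → ℕ) → (∀ x → f x + g x ≤ h x + k x + l x) → ∀ xs →
  sum (map f xs) + sum (map g xs) ≤ sum (map h xs) + sum (map k xs) + sum (map l xs)
sum-+-≤ f g h k l le []       = z≤n
sum-+-≤ f g h k l le (x ∷ xs) = begin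
  (f x + sum (map f xs)) + (g x + sum (map g xs))   ≡⟨ swap₂ (f x) _ (g x) _ ⟩
  (f x + g x) + (sum (map f xs) + sum (map g xs))   ≤⟨ +-mono-≤ (le x) (sum-+-≤ f g h k l le xs) ⟩
  (h x + k x + l x) + (sum (map h xs) + sum (map k xs) + sum (map l xs))
    ≡⟨ swap₃ (h x) (k x) (l x) _ _ _ ⟩
  (h x + sum (map h xs)) + (k x + sum (map k xs)) + (l x + sum (map l xs)) ∎
  where
  open ≤-Reasoning
  swap₂ : ∀ a b c d → (a + b) + (c + d) ≡ (a + c) + (b + d)
  swap₂ = solve-∀
  swap₃ : ∀ a b c d e f → (a + b + c) + (d + e + f) ≡ (a + d) + (b + e) + (c + f)
  swap₃ = solve-∀

module _ {n : ℕ} (D : Digraph n) where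

  Linked : Fin n → Fin n → Set
  Linked u v = Dominated D u v ⊎ Dominating D u v

  DegreeCondition : Set
  DegreeCondition = ∀ (u v : Fin n) → Nonadjacent D u v → Linked u v →
    (2 * n ≤ deg D u + deg D v + 3)
    × (n ≤ ((indeg D u + outdeg D v) ⊓ (outdeg D u + indeg D v)) + 2)

not-swap : ∀ {b c} → not b ≡ c → b ≡ not c
not-swap {false} refl = refl
not-swap {true}  refl = refl

module Core {n : ℕ} (D : Digraph n) (strong : Strong D)
  (hyp : DegreeCondition D) (ℓ : Fin n → Fin n) where

  P : Fin n → Fin n → Set
  P s e = Tr D (λ v → ℓ v ≡ ℓ s) s e

  TrL : List (Fin n) → Fin n → Fin n → Set
  TrL ls s e = Tr D (λ v → ℓ v ∈ ls) s e

  module _ (P-refl : ∀ v → P v v)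
    (no-merge : ∀ {ls ls′ s e s′ e′} → (∀ {i} → i ∈ ls → i ∈ ls′ → ⊥) →
      TrL ls s e → TrL ls′ s′ e′ → Arc D e s′ → Arc D e′ s → ⊥) where

    class-P : ∀ {i s e} → Tr D (λ v → ℓ v ≡ i) s e → P s e
    class-P t = map-Tr D (λ e → trans e (sym eq)) (λ e → trans e eq) t
      where eq = Trail.start (proj₂ t)

    ℓ-end : ∀ {s e} → P s e → ℓ e ≡ ℓ s
    ℓ-end = end∈ D

    P⇒TrL : ∀ {s e} → P s e → TrL [ ℓ s ] s e
    P⇒TrL = map-Tr D here λ { (here eq) → eq }

    extend : ∀ {ls s e s′ e′} → ℓ s′ ∉ ls → TrL ls s e → Arc D e s′ → P s′ e′ → TrL (ℓ s′ ∷ ls) s e′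
    extend ∉ls t a p = map-Tr D (λ { (inj₁ i) → there i ; (inj₂ eq) → here eq })
      (λ { (here eq) → inj₂ eq ; (there i) → inj₁ i })
      (_ , join D (λ i eq → ∉ls (subst (_∈ _) eq i)) (proj₂ t) (proj₂ p) a)

    -- A cycle through several classes, here and in the two longer versions, splits into a trail
    -- through the first class and one through all the others, which `no-merge` excludes.
    no-cycle₂ : ∀ {s e s′ e′} → ℓ s ≢ ℓ s′ → P s e → Arc D e s′ → P s′ e′ → Arc D e′ s → ⊥
    no-cycle₂ apart p a p′ a′ = no-merge (λ { (here refl) (here eq) → apart eq }) (P⇒TrL p) (P⇒TrL p′) a a′

    no-cycle₃ : ∀ {s₁ e₁ s₂ e₂ s₃ e₃} → ℓ s₁ ≢ ℓ s₂ → ℓ s₁ ≢ ℓ s₃ → ℓ s₂ ≢ ℓ s₃ →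
      P s₁ e₁ → Arc D e₁ s₂ → P s₂ e₂ → Arc D e₂ s₃ → P s₃ e₃ → Arc D e₃ s₁ → ⊥
    no-cycle₃ n₁₂ n₁₃ n₂₃ p₁ a₁ p₂ a₂ p₃ a₃ =
      no-merge (λ { (here refl) (here eq) → n₁₃ eq ; (here refl) (there (here eq)) → n₁₂ eq })
        (P⇒TrL p₁) (extend (λ { (here eq) → n₂₃ (sym eq) }) (P⇒TrL p₂) a₂ p₃) a₁ a₃

    no-cycle₄ : ∀ {s₁ e₁ s₂ e₂ s₃ e₃ s₄ e₄} → ℓ s₁ ≢ ℓ s₂ → ℓ s₁ ≢ ℓ s₃ → ℓ s₁ ≢ ℓ s₄ →
      ℓ s₂ ≢ ℓ s₃ → ℓ s₂ ≢ ℓ s₄ → ℓ s₃ ≢ ℓ s₄ →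
      P s₁ e₁ → Arc D e₁ s₂ → P s₂ e₂ → Arc D e₂ s₃ → P s₃ e₃ → Arc D e₃ s₄ → P s₄ e₄ → Arc D e₄ s₁ → ⊥
    no-cycle₄ n₁₂ n₁₃ n₁₄ n₂₃ n₂₄ n₃₄ p₁ a₁ p₂ a₂ p₃ a₃ p₄ a₄ =
      no-merge (λ { (here refl) (here eq) → n₁₄ eq ; (here refl) (there (here eq)) → n₁₃ eq
                  ; (here refl) (there (there (here eq))) → n₁₂ eq })
        (P⇒TrL p₁)
        (extend (λ { (here eq) → n₃₄ (sym eq) ; (there (here eq)) → n₂₄ (sym eq) })
          (extend (λ { (here eq) → n₂₃ (sym eq) }) (P⇒TrL p₂) a₂ p₃) a₃ p₄) a₁ a₄

    module Cross {x u σ ω : Fin n} (ℓx≢ℓu : ℓ x ≢ ℓ u) (xu : Arc D x u) (σx : P σ x) (uω : P u ω) where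

      ℓσ≢ℓu : ℓ σ ≢ ℓ u
      ℓσ≢ℓu eq = ℓx≢ℓu (trans (ℓ-end σx) eq)

      -- `r` omits what rotation pays for: within the class of `σ` the in-neighbours of `σ` are
      -- counted by `I`, within that of `u` the out-neighbours of `ω` by `O`.
      c₁ c₂ r : Fin n → Bool
      c₁ w = does (ℓ w ≟ ℓ σ)
      c₂ w = does (ℓ w ≟ ℓ u)
      r w = if c₁ w then arc D ω w else if c₂ w then arc D w σ else arc D ω w ∨ arc D w σ

      c₁⁻ : ∀ {w} → c₁ w ≡ true → ℓ w ≡ ℓ σ
      c₁⁻ {w} _ with yes eq ← ℓ w ≟ ℓ σ = eq

      c₂⁻ : ∀ {w} → c₂ w ≡ true → ℓ w ≡ ℓ u
      c₂⁻ {w} _ with yes eq ← ℓ w ≟ ℓ u = eq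

      starts = many-starts D c₁ c₁⁻ σx
      ends   = many-ends D c₂ c₂⁻ uω

      -- Z has no repetitions: an arc from ω into I, an arc from O to σ, or arcs ω → w → σ
      -- through a third class would close up trails of different classes.
      I O R Z : List (Fin n)
      I = proj₁ starts
      O = proj₁ ends
      R = sel D r
      Z = I ++ O ++ R

      to-x : ∀ {w} → w ∈ I → P w x
      to-x i = class-P (proj₁ (proj₂ (proj₂ starts)) i)

      from-u : ∀ {w} → w ∈ O → P u w
      from-u = proj₁ (proj₂ (proj₂ ends))

      ℓI : ∀ {w} → w ∈ I → ℓ w ≡ ℓ σ
      ℓI i = Trail.start (proj₂ (proj₁ (proj₂ (proj₂ starts)) i))

      ℓO : ∀ {w} → w ∈ O → ℓ w ≡ ℓ u
      ℓO i = ℓ-end (from-u i)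

      R⁻ : ∀ {w} → w ∈ R → r w ≡ true
      R⁻ = ∈-filterᵇ⁻ r (allFin n)

      no-IR : ∀ {w} → w ∈ I → r w ≡ true → ⊥
      no-IR {w} i rw rewrite dec-true (ℓ w ≟ ℓ σ) (ℓI i) =
        no-cycle₂ (λ eq → ℓσ≢ℓu (trans (sym (ℓI i)) eq)) (to-x i) xu uω rw

      no-OR : ∀ {w} → w ∈ O → r w ≡ true → ⊥
      no-OR {w} i rw
        rewrite dec-false (ℓ w ≟ ℓ σ) (λ eq → ℓσ≢ℓu (trans (sym eq) (ℓO i)))
              | dec-true (ℓ w ≟ ℓ u) (ℓO i) =
        no-cycle₂ ℓσ≢ℓu σx xu (from-u i) rw

      Z-unique : Unique Z
      Z-unique = Unique.++⁺ (proj₁ (proj₂ starts))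
        (Unique.++⁺ (proj₁ (proj₂ ends)) (filterᵇ-Unique r (Unique.allFin⁺ n)) (λ { (i , j) → no-OR i (R⁻ j) }))
        (λ { (i , j) → IO i (∈-++⁻ O j) })
        where
        IO : ∀ {w} → w ∈ I → w ∈ O ⊎ w ∈ R → ⊥
        IO i (inj₁ j) = ℓσ≢ℓu (trans (sym (ℓI i)) (ℓO j))
        IO i (inj₂ j) = no-IR i (R⁻ j)

      ind : Bool → ℕ
      ind b = if b then 1 else 0

      pointwise : ∀ w → ind (arc D ω w) + ind (arc D w σ)
        ≤ ind (r w) + ind (c₂ w ∧ arc D ω w) + ind (c₁ w ∧ arc D w σ)
      pointwise w with ℓ w ≟ ℓ σ | ℓ w ≟ ℓ u
      ... | yes p | yes q = ⊥-elim (ℓσ≢ℓu (trans (sym p) q))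
      ... | yes _ | no _  = +-monoˡ-≤ (ind (arc D w σ)) (m≤m+n (ind (arc D ω w)) 0)
      ... | no _  | yes _ = ≤-reflexive (trans (+-comm (ind (arc D ω w)) _) (sym (+-identityʳ _)))
      ... | no p  | no q with arc D ω w in a | arc D w σ in b
      -- Outside both classes `r` counts `w` once, which suffices since both arcs together would
      -- close a cycle through three classes.
      ...   | true  | true  = ⊥-elim (no-cycle₃ ℓσ≢ℓu (p ∘ sym) (q ∘ sym) σx xu uω a (P-refl w) b)
      ...   | true  | false = s≤s z≤n
      ...   | false | true  = s≤s z≤n
      ...   | false | false = z≤n

      -- The 2 collects the extra one from each of the two rotation bounds.
      length-Z : outdeg D ω + indeg D σ + 2 ≤ length Z
      length-Z = begin
        outdeg D ω + indeg D σ + 2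
          ≤⟨ +-monoˡ-≤ 2 (sum-+-≤ _ _ _ _ _ pointwise (allFin n)) ⟩
        countV D r + countV D (λ w → c₂ w ∧ arc D ω w) + countV D (λ w → c₁ w ∧ arc D w σ) + 2
          ≡⟨ rearrange (countV D r) _ _ ⟩
        suc (countV D (λ w → c₁ w ∧ arc D w σ)) + (suc (countV D (λ w → c₂ w ∧ arc D ω w)) + countV D r)
          ≤⟨ +-mono-≤ (proj₂ (proj₂ (proj₂ starts)))
               (+-mono-≤ (proj₂ (proj₂ (proj₂ ends))) (≤-reflexive (sym (length-sel D r)))) ⟩
        length I + (length O + length R)
          ≡⟨ trans (length-++ I) (cong (length I +_) (length-++ O)) ⟨
        length Z ∎
        where
        open ≤-Reasoning
        rearrange : ∀ a b c → a + b + c + 2 ≡ suc c + (suc b + a)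
        rearrange = solve-∀

      length-≤n : ∀ {L : List (Fin n)} → Unique L → length L ≤ n
      length-≤n u = ≤-trans (unique-⊆-length u (λ _ → ∈-allFin _)) (≤-reflexive (length-tabulate (λ i → i)))

      bound : outdeg D ω + indeg D σ + 2 ≤ n
      bound = ≤-trans length-Z (length-≤n Z-unique)

      -- Equality leaves no vertex outside `Z`, so a vertex excluded from two of the three lists
      -- lies in the third.
      module Tight (tight : n ≤ indeg D σ + outdeg D ω + 2) where

        all∈Z : ∀ w → w ∈ I ⊎ w ∈ O ⊎ r w ≡ true
        all∈Z w with w ∈V? Z
        ... | yes i = Sum.map₂ (λ j → Sum.map₂ R⁻ (∈-++⁻ O j)) (∈-++⁻ I i)
        ... | no w∉ = ⊥-elim (<⇒≱ (length-≤n (Unique-∷⁺ w∉ Z-unique))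
          (≤-trans tight (≤-trans (≤-reflexive (cong (_+ 2) (+-comm (indeg D σ) _))) length-Z)))

        non-out : ∀ {w} → ℓ w ≡ ℓ σ → arc D ω w ≡ false → P w x
        non-out {w} eq f with all∈Z w
        ... | inj₁ i        = to-x i
        ... | inj₂ (inj₁ i) = ⊥-elim (ℓσ≢ℓu (trans (sym eq) (ℓO i)))
        ... | inj₂ (inj₂ rw) rewrite dec-true (ℓ w ≟ ℓ σ) eq = ⊥-elim (true≢false rw f)

        non-in : ∀ {w} → ℓ w ≡ ℓ u → arc D w σ ≡ false → P u w
        non-in {w} eq f with all∈Z w
        ... | inj₁ i        = ⊥-elim (ℓσ≢ℓu (trans (sym (ℓI i)) eq))
        ... | inj₂ (inj₁ i) = from-u i
        ... | inj₂ (inj₂ rw)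
          rewrite dec-false (ℓ w ≟ ℓ σ) (λ e → ℓσ≢ℓu (trans (sym e) eq))
                | dec-true (ℓ w ≟ ℓ u) eq = ⊥-elim (true≢false rw f)

        elsewhere : ∀ {w} → ℓ w ≢ ℓ σ → ℓ w ≢ ℓ u → arc D ω w ≡ false → Arc D w σ
        elsewhere {w} n₁ n₂ f with all∈Z w
        ... | inj₁ i        = ⊥-elim (n₁ (ℓI i))
        ... | inj₂ (inj₁ i) = ⊥-elim (n₂ (ℓO i))
        ... | inj₂ (inj₂ rw)
          rewrite dec-false (ℓ w ≟ ℓ σ) n₁ | dec-false (ℓ w ≟ ℓ u) n₂ | f = rw

    -- `Cross.bound` applies to `x → u` and, with `σ` and `ω` exchanged, to `p → z`. The two bounds
    -- add up to d(σ) + d(ω) ≤ 2n - 4, one less than the degree condition allows.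
    opposite : ∀ {x u p z σ ω} → ℓ x ≢ ℓ u → Arc D x u → Arc D p z →
      P σ x → P u ω → P z σ → P ω p → Nonadjacent D σ ω → Linked D σ ω → ⊥
    opposite {σ = σ} {ω} ℓx≢ℓu xu pz σx uω zσ ωp non link = <⇒≱ lt (proj₁ (hyp σ ω non link))
      where
      ℓp≢ℓz : ℓ _ ≢ ℓ _
      ℓp≢ℓz eq = ℓx≢ℓu (trans (ℓ-end σx) (trans (ℓ-end zσ)
        (trans (sym eq) (trans (ℓ-end ωp) (ℓ-end uω)))))
      lt : deg D σ + deg D ω + 3 < 2 * n
      lt = begin-strict
        deg D σ + deg D ω + 3 ≡⟨ regroup₁ (indeg D σ) (outdeg D σ) (indeg D ω) (outdeg D ω) ⟩
        3 + (outdeg D ω + indeg D σ + (outdeg D σ + indeg D ω)) <⟨ ≤-refl ⟩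
        4 + (outdeg D ω + indeg D σ + (outdeg D σ + indeg D ω))
          ≡⟨ regroup₂ (outdeg D ω + indeg D σ) (outdeg D σ + indeg D ω) ⟩
        (outdeg D ω + indeg D σ + 2) + (outdeg D σ + indeg D ω + 2)
          ≤⟨ +-mono-≤ (Cross.bound ℓx≢ℓu xu σx uω) (Cross.bound ℓp≢ℓz pz ωp zσ) ⟩
        n + n ≡⟨ cong (n +_) (+-identityʳ n) ⟨
        2 * n ∎
        where
        open ≤-Reasoning
        regroup₁ : ∀ a b c d → (a + b) + (c + d) + 3 ≡ 3 + (d + a + (b + c))
        regroup₁ = solve-∀
        regroup₂ : ∀ a b → 4 + (a + b) ≡ (a + 2) + (b + 2)
        regroup₂ = solve-∀

    -- Adjacency of linked pairs, and complete sets of arcs between classes.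

    no-closed-set : (q : Fin n → Bool) → ∀ {a b} → q a ≡ true → q b ≡ false →
      (∀ {v w} → Arc D v w → q v ≡ true → q w ≡ false → ⊥) → ⊥
    no-closed-set q {a} {b} qa qb closed = go (strong a b) qa
      where
      go : ∀ {v} → Reach D v b → q v ≡ true → ⊥
      go here        qv = true≢false qv qb
      go (step {y = y} a r) qv with q y in qy
      ... | true  = go r qy
      ... | false = closed a qv qy

    -- The semidegree condition makes the count in `Cross` tight. With arcs back at `σ` and `ω`
    -- ruled out by `opposite`, every vertex of the class of `σ` starts a trail to `x` and every
    -- vertex of the class of `u` ends one from `u`; then no arc leaves `q`.
    linked-adjacent : ∀ {x u σ ω} → ℓ x ≢ ℓ u → Arc D x u → P σ x → P u ω →
      Nonadjacent D σ ω → Linked D σ ω → ⊥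
    linked-adjacent {x} {u} {σ} {ω} ℓx≢ℓu xu σx uω non link =
      no-closed-set q q-u q-x closed
      where
      open Cross ℓx≢ℓu xu σx uω
      open Tight (≤-trans (proj₂ (hyp σ ω non link)) (+-monoˡ-≤ 2 (m⊓n≤m _ _)))

      -- Some arc `v → z′` of a closed trail of the class enters the out-neighbourhood of `ω`. Then
      -- `v` and `ω` both dominate `z′`, `non-out` gives `P v x`, and `ω → z′` is the arc back that
      -- `opposite` needs.
      ω-out : ∀ {z} → ℓ z ≡ ℓ σ → Arc D ω z → ⊥
      ω-out {z} eq ωz
        with transition D (arc D ω) (P-refl x)
               (¬true⇒false λ ωx → no-cycle₂ ℓx≢ℓu (P-refl x) xu uω ωx) (trans eq (sym (ℓ-end σx))) ωz
      ... | v , z′ , vz′ , z′v , ωv , ωz′ =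
        opposite ℓx≢ℓu xu ωz′ (non-out ℓv ωv) uω
          (class-P z′v) (P-refl ω)
          ( (λ { refl → ℓσ≢ℓu (trans (sym ℓv) (ℓ-end uω)) })
          , ¬true⇒false (λ vω → no-cycle₂ ℓz′≢ℓω (class-P z′v) vω (P-refl ω) ωz′)
          , ωv )
          (inj₂ (z′ , vz′ , ωz′))
        where
        ℓz′ : ℓ z′ ≡ ℓ x
        ℓz′ = Trail.start (proj₂ z′v)
        ℓv : ℓ v ≡ ℓ σ
        ℓv = trans (end∈ D z′v) (ℓ-end σx)
        ℓz′≢ℓω : ℓ z′ ≢ ℓ ω
        ℓz′≢ℓω e = ℓx≢ℓu (trans (sym ℓz′) (trans e (ℓ-end uω)))

      -- Dually, some arc `p′ → w` leaves the in-neighbourhood of `σ`, so that `p′` dominates both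
      -- `σ` and `w`.
      σ-in : ∀ {p} → ℓ p ≡ ℓ u → Arc D p σ → ⊥
      σ-in {p} eq pσ
        with transition D (λ w → not (arc D w σ)) (P-refl p) (cong not pσ) (sym eq)
               (cong not (¬true⇒false λ uσ → no-cycle₂ ℓσ≢ℓu σx xu (P-refl u) uσ))
      ... | p′ , w , p′w , wp′ , np′ , nw =
        opposite ℓx≢ℓu xu p′σ σx (non-in ℓw wσ) (P-refl σ) wp
          ( (λ { refl → ℓσ≢ℓu ℓw })
          , ¬true⇒false (λ σw → no-cycle₂ (λ e → ℓσ≢ℓu (trans e ℓw)) (P-refl σ) σw wp p′σ)
          , wσ )
          (inj₁ (p′ , p′σ , p′w))
        where
        p′σ : Arc D p′ σ
        p′σ = not-swap np′
        wσ : arc D w σ ≡ false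
        wσ = not-swap nw
        ℓw : ℓ w ≡ ℓ u
        ℓw = trans (Trail.start (proj₂ wp′)) eq
        wp : P w p′
        wp = class-P wp′

      to-all : ∀ {w} → ℓ w ≡ ℓ σ → P w x
      to-all eq = non-out eq (¬true⇒false (ω-out eq))

      from-all : ∀ {w} → ℓ w ≡ ℓ u → P u w
      from-all eq = non-in eq (¬true⇒false (σ-in eq))

      -- In a third class, a vertex in `q` is entered from `ω`, and one outside `q` dominates `σ` by
      -- `elsewhere`. An arc leaving `q` therefore closes a cycle of classes through `x → u`.
      q : Fin n → Bool
      q w = if c₁ w then false else if c₂ w then true else arc D ω w

      q-u : q u ≡ true
      q-u rewrite dec-false (ℓ u ≟ ℓ σ) (ℓσ≢ℓu ∘ sym) | dec-true (ℓ u ≟ ℓ u) refl = refl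

      q-x : q x ≡ false
      q-x rewrite dec-true (ℓ x ≟ ℓ σ) (ℓ-end σx) = refl

      closed : ∀ {a b} → Arc D a b → q a ≡ true → q b ≡ false → ⊥
      closed {a} {b} ab qa qb with ℓ a ≟ ℓ σ | ℓ a ≟ ℓ u | ℓ b ≟ ℓ σ | ℓ b ≟ ℓ u
      closed ab () qb | yes _ | _ | _ | _
      closed ab qa () | no _ | _ | no _ | yes _
      closed ab qa qb | no _  | yes a₂ | yes b₁ | _ =
        no-cycle₂ (λ e → ℓσ≢ℓu (trans (sym b₁) e)) (to-all b₁) xu (from-all a₂) ab
      closed ab qa qb | no _  | yes a₂ | no b₁  | no b₂ =
        no-cycle₃ ℓσ≢ℓu (b₁ ∘ sym) (b₂ ∘ sym) σx xu (from-all a₂) ab (P-refl _) (elsewhere b₁ b₂ qb)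
      closed ab qa qb | no a₁ | no a₂  | yes b₁ | _ =
        no-cycle₃ (λ e → ℓσ≢ℓu (trans (sym b₁) e)) (λ e → a₁ (trans (sym e) b₁)) (a₂ ∘ sym)
          (to-all b₁) xu uω qa (P-refl _) ab
      closed {a} {b} ab qa qb | no a₁ | no a₂ | no b₁ | no b₂ with ℓ a ≟ ℓ b
      ... | no a≢b =
        no-cycle₄ ℓσ≢ℓu (a₁ ∘ sym) (b₁ ∘ sym) (a₂ ∘ sym) (b₂ ∘ sym) a≢b
          σx xu uω qa (P-refl a) ab (P-refl b) (elsewhere b₁ b₂ qb)
      -- Inside one third class the arc from `a` to `b` need not be on a suitable trail; the cut
      -- closed trail gives an entry `z` from `ω` and an exit `v` to `σ` instead.
      ... | yes a≡b with transition D (arc D ω) (P-refl b) qb a≡b qa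
      ...   | v , z , vz , zv , ωv , ωz =
        no-cycle₃ ℓσ≢ℓu (λ e → b₁ (sym (trans e ℓz))) (λ e → b₂ (sym (trans e ℓz))) σx xu uω ωz
          (class-P zv)
          (elsewhere (λ e → b₁ (trans (sym (end∈ D zv)) e)) (λ e → b₂ (trans (sym (end∈ D zv)) e)) ωv)
        where
        ℓz : ℓ z ≡ ℓ b
        ℓz = Trail.start (proj₂ zv)

    -- Otherwise the closed trail of the class has an arc `v → z` where `v` dominates `u` and `z`
    -- does not. Then `z` and `u` are nonadjacent and dominated by `v`, against `linked-adjacent`.
    left-full : ∀ {x u a} → ℓ x ≢ ℓ u → Arc D x u → ℓ a ≡ ℓ x → Arc D a u
    left-full {x} {u} {a} apart xu eq with arc D a u in au
    ... | true  = refl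
    ... | false with transition D (λ w → not (arc D w u)) (P-refl x) (cong not xu) eq (cong not au)
    ...   | v , z , vz , zv , nv , nz = ⊥-elim (linked-adjacent
        (λ e → apart (trans (sym (end∈ D zv)) e)) vu zv′ (P-refl u)
        ( (λ { refl → apart (sym ℓz) })
        , zu
        , ¬true⇒false (λ uz → no-cycle₂ (λ e → apart (trans (sym ℓz) e)) zv′ vu (P-refl u) uz) )
        (inj₁ (v , vz , vu)))
      where
      ℓz : ℓ z ≡ ℓ x
      ℓz = Trail.start (proj₂ zv)
      zv′ : P z v
      zv′ = class-P zv
      vu : Arc D v u
      vu = not-swap nv
      zu : arc D z u ≡ false
      zu = not-swap nz

    -- Here the offending pair is `x` and `v`, which both dominate `z`.
    right-full : ∀ {x u b} → ℓ x ≢ ℓ u → Arc D x u → ℓ b ≡ ℓ u → Arc D x b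
    right-full {x} {u} {b} apart xu eq with arc D x b in xb
    ... | true  = refl
    ... | false with transition D (arc D x) (P-refl b) xb (sym eq) xu
    ...   | v , z , vz , zv , xv , xz = ⊥-elim (linked-adjacent x≢z xz (P-refl x) zv′
        ( (λ { refl → apart (trans (end∈ D zv) eq) })
        , xv
        , ¬true⇒false (λ vx → no-cycle₂ x≢z (P-refl x) xz zv′ vx) )
        (inj₂ (z , xz , vz)))
      where
      ℓz : ℓ z ≡ ℓ b
      ℓz = Trail.start (proj₂ zv)
      x≢z : ℓ x ≢ ℓ z
      x≢z e = apart (trans e (trans ℓz eq))
      zv′ : P z v
      zv′ = class-P zv

    -- Chains of classes along a directed path.

    -- Chains avoid the class of x and leave each class as soon as they enter it, so by
    -- right-full a chain can be cut back to end at any vertex of a class it meets.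
    data Chain (x : Fin n) : List (Fin n) → Fin n → Set where
      start : ∀ {s} → ℓ x ≢ ℓ s → Arc D x s → Chain x [ ℓ s ] s
      next  : ∀ {ls e b} → Chain x ls e → Arc D e b → ℓ b ∉ ls → ℓ b ≢ ℓ x → Chain x (ℓ b ∷ ls) b

    chain-end : ∀ {x ls e} → Chain x ls e → ℓ e ∈ ls
    chain-end (start _ _)    = here refl
    chain-end (next _ _ _ _) = here refl

    chain-to : ∀ {x ls e b} → Chain x ls e → ℓ b ∈ ls → ∃[ ls′ ] Chain x ls′ b
    chain-to (start apart xs) (here eq) = _ , start (λ e → apart (trans e eq)) (right-full apart xs eq)
    chain-to (next c eb ∉ls apart) (here eq) =
      _ , next c (right-full (λ e → ∉ls (subst (_∈ _) e (chain-end c))) eb eq)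
        (λ i → ∉ls (subst (_∈ _) eq i)) (λ e → apart (trans (sym eq) e))
    chain-to (next c _ _ _) (there i) = chain-to c i

    chain-trail : ∀ {x ls e} → Chain x ls e →
      ∃[ s ] ℓ x ≢ ℓ s × Arc D x s × ℓ x ∉ ls × TrL ls s e
    chain-trail (start apart xs) = _ , apart , xs , (λ { (here eq) → apart eq }) , P⇒TrL (P-refl _)
    chain-trail (next c eb ∉ls apart) with chain-trail c
    ... | s , x≢s , xs , x∉ , t =
      s , x≢s , xs , (λ { (here eq) → apart (sym eq) ; (there i) → x∉ i }) , extend ∉ls t eb (P-refl _)

    -- Along the path to `x`, a step into a fresh class extends the chain and a step into a class
    -- already met cuts it back. A step into the class of `x` closes a cycle, as `left-full` makes
    -- the vertex reached dominate the first vertex of the chain.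
    chain-blocked : ∀ {x e ls} → Reach D e x → Chain x ls e → ⊥
    chain-blocked here c = proj₁ (proj₂ (proj₂ (proj₂ (chain-trail c)))) (chain-end c)
    chain-blocked {x} {e} {ls} (step {y = y} ey r) c with ℓ y ≟ ℓ x
    ... | yes eq with chain-trail c
    ...   | s , x≢s , xs , x∉ , t =
      no-merge (λ { i (here refl) → x∉ (subst (_∈ ls) eq i) }) t (P⇒TrL (P-refl y)) ey (left-full x≢s xs eq)
    chain-blocked {x} {e} {ls} (step {y = y} ey r) c | no y≢x with ℓ y ∈V? ls
    ... | yes i = chain-blocked r (proj₂ (chain-to c i))
    ... | no ∉ls = chain-blocked r (next c ey ∉ls y≢x)

    -- A path from `a` to `b` changes class at some arc `v → y`, and strong connectivity leads from
    -- `y` back to `v`, where `chain-blocked` applies.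
    one-class : ∀ {a b} → ℓ a ≢ ℓ b → ⊥
    one-class {a} {b} a≢b = go (strong a b) a≢b
      where
      go : ∀ {v} → Reach D v b → ℓ v ≢ ℓ b → ⊥
      go here apart = apart refl
      go {v} (step {y = y} vy r) apart with ℓ v ≟ ℓ y
      ... | yes eq = go r (λ e → apart (trans eq e))
      ... | no v≢y = chain-blocked (strong y v) (start v≢y vy)

-- Decidability, and induction on the number of classes.

module _ {n : ℕ} (D : Digraph n) where

  arcsOf-walk : ∀ {s as e} → Walk D s as e → arcsOf D (s ∷ map proj₂ as) ≡ as
  arcsOf-walk []                  = refl
  arcsOf-walk (_∷_ {x = x} {y} a w) = cong ((x , y) ∷_) (arcsOf-walk w)

  last-walk : ∀ {s as e} → Walk D s as e → last (s ∷ map proj₂ as) ≡ just e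
  last-walk []      = refl
  last-walk (a ∷ w) = last-walk w

  arcs-walk : ∀ {s as e} → Walk D s as e → All (λ p → Arc D (proj₁ p) (proj₂ p)) as
  arcs-walk []      = []
  arcs-walk (a ∷ w) = a ∷ arcs-walk w

  spanning⇒supereulerian : ∀ {S v} → (∀ w → S w) → Tr D S v v → Supereulerian D
  spanning⇒supereulerian {v = v} full (as , mkTrail w u _ _ cover) =
    v , map proj₂ as ,
    ( subst (All _) (sym (arcsOf-walk w)) (arcs-walk w)
    , subst Unique (sym (arcsOf-walk w)) u
    , last-walk w ) ,
    λ x → visited (cover (full x))
    where
    visited : ∀ {x} → x ≡ v ⊎ Hit D as x → x ∈ v ∷ map proj₂ as
    visited (inj₁ eq)      = here eq
    visited (inj₂ (u , i)) = there (∈-map⁺ proj₂ i)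

  bounded? : ∀ k {Q : List (Fin n) → Set} → (∀ xs → Dec (Q xs)) → Dec (∃[ xs ] length xs ≤ k × Q xs)
  bounded? zero Q? = map′ (λ q → [] , z≤n , q) (λ { ([] , _ , q) → q }) (Q? [])
  bounded? (suc k) {Q} Q? = map′ to from (Q? [] ⊎-dec Fin.any? λ x → bounded? k (λ xs → Q? (x ∷ xs)))
    where
    to : Q [] ⊎ (∃[ x ] ∃[ xs ] length xs ≤ k × Q (x ∷ xs)) → ∃[ xs ] length xs ≤ suc k × Q xs
    to (inj₁ q)               = [] , z≤n , q
    to (inj₂ (x , xs , l , q)) = x ∷ xs , s≤s l , q
    from : (∃[ xs ] length xs ≤ suc k × Q xs) → Q [] ⊎ (∃[ x ] ∃[ xs ] length xs ≤ k × Q (x ∷ xs))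
    from ([] , _ , q)           = inj₁ q
    from (x ∷ xs , s≤s l , q) = inj₂ (x , xs , l , q)

  length-arcsOf : ∀ x xs → length (arcsOf D (x ∷ xs)) ≡ length xs
  length-arcsOf x []       = refl
  length-arcsOf x (y ∷ xs) = cong suc (length-arcsOf y xs)

  Spanning : Fin n → List (Fin n) → Set
  Spanning x xs = IsClosedTrail D x xs × (∀ v → v ∈ x ∷ xs)

  spanning? : ∀ x xs → Dec (Spanning x xs)
  spanning? x xs =
    (All.all? (λ p → arc D (proj₁ p) (proj₂ p) Bool.≟ true) _
      ×-dec DecUnique.unique? _≟A_ _
      ×-dec Maybe.≡-dec _≟_ _ _)
    ×-dec Fin.all? (λ v → v ∈V? (x ∷ xs))

  -- The extremal argument is classical and only refutes ¬ Supereulerian; a closed trail has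
  -- at most n² arcs, so a bounded search recovers a witness.
  maxLength : ℕ
  maxLength = length (cartesianProduct (allFin n) (allFin n))

  supereulerian? : Dec (Supereulerian D)
  supereulerian? = map′ (λ { (x , xs , _ , sp) → x , xs , sp })
    (λ { (x , xs , sp@((_ , u , _) , _)) → x , xs ,
      ≤-trans (≤-reflexive (sym (length-arcsOf x xs)))
        (unique-⊆-length u (λ _ → ∈-cartesianProduct⁺ (∈-allFin _) (∈-allFin _))) , sp })
    (Fin.any? λ x → bounded? maxLength (spanning? x))

  module _ (strong : Strong D) (hyp : DegreeCondition D) (v₀ : Fin n) where

    -- `used` bounds the number of classes. A possible merge would give all merged classes the label
    -- `ℓ s` and free `ℓ s′`, so induction would refute `¬super`. Hence nothing merges, `one-class`
    -- leaves a single class, and its closed trail spans.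
    not-not-supereulerian : ∀ k (used : List (Fin n)) → length used < k →
      (ℓ : Fin n → Fin n) → (∀ v → ℓ v ∈ used) → (∀ v → Core.P D strong hyp ℓ v v) → ¬ ¬ Supereulerian D
    not-not-supereulerian (suc k) used (s≤s len) ℓ ℓ∈ P-refl ¬super =
      ¬super (spanning⇒supereulerian all-equal (P-refl v₀))
      where
      open Core D strong hyp ℓ

      no-merge : ∀ {ls ls′ s e s′ e′} → (∀ {i} → i ∈ ls → i ∈ ls′ → ⊥) →
        TrL ls s e → TrL ls′ s′ e′ → Arc D e s′ → Arc D e′ s → ⊥
      no-merge {ls} {ls′} {s} {e} {s′} disj t t′ a a′ =
        not-not-supereulerian k used′ (≤-trans shorter len) ℓ′ ℓ′∈ P′-refl ¬super
        where
        merged : Tr D (λ v → ℓ v ∈ ls ⊎ ℓ v ∈ ls′) s s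
        merged = merge D disj t t′ a a′
        s∈ : ℓ s ∈ ls
        s∈ = Trail.start (proj₂ t)
        s′∈ : ℓ s′ ∈ ls′
        s′∈ = Trail.start (proj₂ t′)
        in? : ∀ v → Dec (ℓ v ∈ ls ⊎ ℓ v ∈ ls′)
        in? v = (ℓ v ∈V? ls) ⊎-dec (ℓ v ∈V? ls′)
        ℓ′ : Fin n → Fin n
        ℓ′ v = if does (in? v) then ℓ s else ℓ v
        ℓ′-in : ∀ {v} → ℓ v ∈ ls ⊎ ℓ v ∈ ls′ → ℓ′ v ≡ ℓ s
        ℓ′-in {v} i rewrite dec-true (in? v) i = refl
        ℓ′-out : ∀ {v} → ¬ (ℓ v ∈ ls ⊎ ℓ v ∈ ls′) → ℓ′ v ≡ ℓ v
        ℓ′-out {v} o rewrite dec-false (in? v) o = refl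
        ℓ′-in⁻ : ∀ {v} → ℓ′ v ≡ ℓ s → ℓ v ∈ ls ⊎ ℓ v ∈ ls′
        ℓ′-in⁻ {v} eq with in? v
        ... | yes i = i
        ... | no o  = inj₁ (subst (_∈ ls) (trans (sym eq) (ℓ′-out o)) s∈)
        kept? : ∀ i → Dec (i ≢ ℓ s′)
        kept? i = ¬? (i ≟ ℓ s′)
        used′ : List (Fin n)
        used′ = filter kept? used
        shorter : length used′ < length used
        shorter = filter-notAll kept? used (Any.map (λ eq h → h (sym eq)) (ℓ∈ s′))
        ℓ′∈ : ∀ v → ℓ′ v ∈ used′
        ℓ′∈ v = go (in? v)
          where
          go : Dec (ℓ v ∈ ls ⊎ ℓ v ∈ ls′) → ℓ′ v ∈ used′
          go (yes i) = subst (_∈ used′) (sym (ℓ′-in i))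
            (∈-filter⁺ kept? (ℓ∈ s) (λ eq → disj s∈ (subst (_∈ ls′) (sym eq) s′∈)))
          go (no o) = subst (_∈ used′) (sym (ℓ′-out o))
            (∈-filter⁺ kept? (ℓ∈ v) (λ eq → o (inj₂ (subst (_∈ ls′) (sym eq) s′∈))))
        P′-refl : ∀ v → Core.P D strong hyp ℓ′ v v
        P′-refl v = go (in? v)
          where
          go : Dec (ℓ v ∈ ls ⊎ ℓ v ∈ ls′) → Core.P D strong hyp ℓ′ v v
          go (yes i) = map-Tr D (λ j → trans (ℓ′-in j) (sym (ℓ′-in i))) (λ eq → ℓ′-in⁻ (trans eq (ℓ′-in i)))
            (rotate D merged i)
          go (no o) = map-Tr D
            (λ eq → trans (ℓ′-out (λ j → o (subst (λ l → l ∈ ls ⊎ l ∈ ls′) eq j))) (trans eq (sym (ℓ′-out o))))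
            back
            (P-refl v)
            where
            back : ∀ {w} → ℓ′ w ≡ ℓ′ v → ℓ w ≡ ℓ v
            back {w} eq = go′ (in? w)
              where
              go′ : Dec (ℓ w ∈ ls ⊎ ℓ w ∈ ls′) → ℓ w ≡ ℓ v
              go′ (yes j) = ⊥-elim (o (ℓ′-in⁻ (trans (sym eq) (ℓ′-in j))))
              go′ (no o′) = trans (sym (ℓ′-out o′)) (trans eq (ℓ′-out o))

      all-equal : ∀ w → ℓ w ≡ ℓ v₀
      all-equal w with ℓ w ≟ ℓ v₀
      ... | yes eq = eq
      ... | no neq = ⊥-elim (one-class P-refl no-merge neq)

    supereulerian : Supereulerian D
    supereulerian = decidable-stable supereulerian?
      (not-not-supereulerian (suc n) (allFin n) (s≤s (≤-reflexive (length-tabulate (λ i → i))))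
        (λ v → v) ∈-allFin (λ v → [] , mkTrail [] [] refl (λ ()) inj₁))

theorem3 : (n : ℕ) → 1 ≤ n → (D : Digraph n) → Strong D →
    (∀ (u v : Fin n) → Nonadjacent D u v → (Dominated D u v ⊎ Dominating D u v) →
    (2 * n ≤ deg D u + deg D v + 3)
    × (n ≤ ((indeg D u + outdeg D v) ⊓ (outdeg D u + indeg D v)) + 2)) →
    Supereulerian D
theorem3 (suc n) _ D strong hyp = supereulerian D strong hyp zero
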